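{- Let $n\ge3$, $\varphi\in S_n$, and let $x,y$ be two different points of $\mathfrak{M}_{(n,\varphi)}$. Then the number of blocks of $\mathfrak{M}_{(n,\varphi)}$ containing both $x$ and $y$ is $0$, $1$, $2$, or $n-2$.
   Context: Let $n\ge 3$, $I=\{1,\dots,n\}$, $\varphi\in S_n$ a permutation of $I$, and let $A=\{a_1,\dots,a_n\}$, $B=\{b_1,\dots,b_n\}$ be disjoint $n$-element sets. For $i\in I$ put $A_i=(A\setminus\{a_i\})\cup\{b_i\}$ and $B_i=(B\setminus\{b_i\})\cup\{a_{\varphi(i)}\}$. The Möbius $n$-pair $\mathfrak{M}_{(n,\varphi)}$ is the point-block structure with point set $A\cup B$ and block set $\{A_i: i\in I\}\cup\{B_i: i\in I\}$. -}

module Defs where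

open import Level using (Level; suc; _⊔_)
open import Data.Nat.Base using (ℕ)
open import Data.Fin.Base using (Fin)
open import Data.Fin.Permutation using (Permutation′; _⟨$⟩ʳ_)
open import Data.Product.Base using (Σ-syntax; ∃-syntax; _×_; proj₁)
open import Data.Sum.Base using (_⊎_)
open import Function.Bundles using (Inverse)
open import Function.Definitions using (Injective)
open import Relation.Binary.Bundles using (Setoid)
open import Relation.Binary.PropositionalEquality using (_≡_; setoid)
open import Relation.Unary using (Pred; _∈_; _≐_; _⊥_; _∪_; _∖_; ｛_｝; ⋃)
open import Relation.Unary.Relation.Binary.Equality using (≐-setoid)
import Relation.Binary.Construct.On as On

-- Subsets of X are predicates, and two subsets are equal when they have the
-- same elements (_≐_).  Accordingly the number of subsets with a property is
-- counted up to _≐_: there are k of them when the setoid of such subsets is in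
-- bijection with Fin k.

module _ {ℓ p : Level} {X : Set ℓ} where

  subsetsSatisfying : Pred (Pred X ℓ) p → Setoid (suc ℓ ⊔ p) ℓ
  subsetsSatisfying P = On.setoid {B = Σ[ S ∈ Pred X ℓ ] P S} (≐-setoid X ℓ) proj₁

  NumberOf_Is_ : Pred (Pred X ℓ) p → ℕ → Set (suc ℓ ⊔ p)
  NumberOf P Is k = Inverse (subsetsSatisfying P) (setoid (Fin k))

record PointBlockStructure {ℓ : Level} (X : Set ℓ) : Set (suc ℓ) where
  field
    Point : Pred X ℓ
    Block : Pred (Pred X ℓ) ℓ

  BlockThrough : X → X → Pred (Pred X ℓ) ℓ
  BlockThrough x y S = S ∈ Block × x ∈ S × y ∈ S

-- The index set {1,…,n} is Fin n.  An n-element set {a₁,…,aₙ} is the image of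
-- an injective labelling a.

module _ {ℓ : Level} {X : Set ℓ} {n : ℕ} where

  image : (Fin n → X) → Pred X ℓ
  image a = ⋃[ i ∶ Fin n ] ｛ a i ｝

  record DisjointLabelling (a b : Fin n → X) : Set ℓ where
    field
      a-injective : Injective _≡_ _≡_ a
      b-injective : Injective _≡_ _≡_ b
      disjoint    : image a ⊥ image b

  module _ (φ : Permutation′ n) (a b : Fin n → X) where

    blockA : Fin n → Pred X ℓ
    blockA i = (image a ∖ ｛ a i ｝) ∪ ｛ b i ｝

    blockB : Fin n → Pred X ℓ
    blockB i = (image b ∖ ｛ b i ｝) ∪ ｛ a (φ ⟨$⟩ʳ i) ｝

    möbiusPair : PointBlockStructure X
    möbiusPair = record
      { Point = image a ∪ image b
      ; Block = λ S → (∃[ i ] S ≐ blockA i) ⊎ (∃[ i ] S ≐ blockB i)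
      }

{-# OPTIONS --safe #-}
-- Both families of blocks have the shape  (image u ∖ ｛ u i ｝) ∪ ｛ v i ｝ :  the Aᵢ
-- with (u , v) = (a , b), the Bᵢ with (u , v) = (b , a ∘ φ).  In such a family
-- u p lies in the i-th block iff i ≢ p, and v q iff i ≡ q.  Two points of image u
-- are thus in n - 2 blocks of the family, two points of image v in none, and a
-- point of each in at most one.  Since n ≥ 3, no Aᵢ is a Bⱼ, so the counts for the
-- two families add up.
module Submission where

open import Defs
open import Level using (Level; _⊔_)
open import Data.Empty using (⊥-elim)
open import Data.Nat.Base using (ℕ; zero; suc; s≤s; _+_; _≤_; _∸_)
open import Data.Nat.Properties using (+-identityʳ)
open import Data.Fin.Base using (Fin; zero; suc; join; splitAt; punchIn; punchOut)
open import Data.Fin.Permutation using (Permutation′; _⟨$⟩ʳ_; _⟨$⟩ˡ_; inverseʳ)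
open import Data.Fin.Properties
  using (_≟_; splitAt-join; join-splitAt; punchIn-injective; punchInᵢ≢i;
         punchIn-punchOut; punchOut-injective)
open import Data.Product.Base using (∃-syntax; _×_; _,_; proj₁; proj₂; swap)
import Data.Sum.Base as Sum
open import Data.Sum.Base using (_⊎_; inj₁; inj₂; [_,_])
open import Data.Sum.Properties using (inj₁-injective; inj₂-injective)
open import Function.Base using (_∘_)
open import Function.Bundles using (Injection)
open import Function.Definitions using (Injective)
open import Function.Properties.Inverse using (Inverse⇒Injection)
open import Relation.Binary.PropositionalEquality
  using (_≡_; _≢_; refl; sym; trans; cong; subst)
open import Relation.Nullary using (yes; no; contradiction)
open import Relation.Unary using (Pred; _∈_; _∉_; _⊈_; _≐_; _∪_; _∖_; ｛_｝)
open import Relation.Unary.Properties using (≐-sym; ≐-trans)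

private
  variable
    ℓ p q : Level
    I J : Set ℓ
    k l n : ℕ

-- Enumerating index sets, and counting subsets by their indices

record Enumeration {ι p : Level} {I : Set ι} (P : Pred I p) (k : ℕ) : Set (ι ⊔ p) where
  field
    index     : Fin k → I
    injective : Injective _≡_ _≡_ index
    sound     : ∀ j → index j ∈ P
    complete  : ∀ {i} → i ∈ P → ∃[ j ] index j ≡ i

open Enumeration

enum-resp-≐ : {P : Pred I p} {Q : Pred I q} → P ≐ Q → Enumeration P k → Enumeration Q k
enum-resp-≐ (P⊆Q , Q⊆P) e = record
  { index     = index e
  ; injective = injective e
  ; sound     = λ j → P⊆Q (sound e j)
  ; complete  = λ i∈Q → complete e (Q⊆P i∈Q)
  }

enum-empty : {P : Pred I p} → (∀ {i} → i ∉ P) → Enumeration P 0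
enum-empty ∉P = record
  { index     = λ ()
  ; injective = λ { {()} }
  ; sound     = λ ()
  ; complete  = λ i∈P → contradiction i∈P ∉P
  }

enum-singleton : (i : I) → Enumeration ｛ i ｝ 1
enum-singleton i = record
  { index     = λ _ → i
  ; injective = λ { {zero} {zero} _ → refl }
  ; sound     = λ _ → refl
  ; complete  = λ i≡j → zero , i≡j
  }

enum-⊎ : {P : Pred (I ⊎ J) p} →
  Enumeration (P ∘ inj₁) k → Enumeration (P ∘ inj₂) l → Enumeration P (k + l)
enum-⊎ {I = I} {J = J} {k = k} {l = l} {P = P} e f = record
  { index     = ix ∘ splitAt k
  ; injective = λ {i} {j} eq → trans (sym (join-splitAt k l i))
      (trans (cong (join k l) (ix-injective (splitAt k i) (splitAt k j) eq)) (join-splitAt k l j))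
  ; sound     = λ j → ix-sound (splitAt k j)
  ; complete  = λ {s} s∈P → let (t , eq) = ix-complete s s∈P
                            in join k l t , trans (cong ix (splitAt-join k l t)) eq
  }
  where
  ix : Fin k ⊎ Fin l → I ⊎ J
  ix = Sum.map (index e) (index f)

  ix-injective : ∀ s t → ix s ≡ ix t → s ≡ t
  ix-injective (inj₁ _) (inj₁ _) eq = cong inj₁ (injective e (inj₁-injective eq))
  ix-injective (inj₂ _) (inj₂ _) eq = cong inj₂ (injective f (inj₂-injective eq))

  ix-sound : ∀ s → ix s ∈ P
  ix-sound (inj₁ j) = sound e j
  ix-sound (inj₂ j) = sound f j

  ix-complete : ∀ s → s ∈ P → ∃[ t ] ix t ≡ s
  ix-complete (inj₁ _) i∈P = let (j , eq) = complete e i∈P in inj₁ j , cong inj₁ eq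
  ix-complete (inj₂ _) i∈P = let (j , eq) = complete f i∈P in inj₂ j , cong inj₂ eq

-- Two punctures: the outer `punchIn i` skips `i`, and the inner one skips `j′`, the position of `j`
-- once `i` has been removed.
enum-avoid₂ : {i j : Fin n} → i ≢ j → Enumeration (λ h → h ≢ i × h ≢ j) (n ∸ 2)
enum-avoid₂ {suc zero}    {zero} {zero} i≢j = contradiction refl i≢j
enum-avoid₂ {suc (suc n)} {i} {j} i≢j = record
  { index     = λ h → punchIn i (punchIn j′ h)
  ; injective = λ eq → punchIn-injective j′ _ _ (punchIn-injective i _ _ eq)
  ; sound     = λ h → punchInᵢ≢i i _
                    , λ eq → punchInᵢ≢i j′ h
                        (punchIn-injective i _ _ (trans eq (sym (punchIn-punchOut i≢j))))
  ; complete  = λ (h≢i , h≢j) →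
      let i≢h   = λ i≡h → h≢i (sym i≡h)
          j′≢h′ = λ eq → h≢j (sym (punchOut-injective i≢j i≢h eq))
      in punchOut j′≢h′
       , trans (cong (punchIn i) (punchIn-punchOut j′≢h′)) (punchIn-punchOut i≢h)
  }
  where
  j′ : Fin (suc n)
  j′ = punchOut i≢j

avoid₂ : 3 ≤ n → (i j : Fin n) → ∃[ h ] h ≢ i × h ≢ j
avoid₂ (s≤s (s≤s (s≤s _))) i j with i ≟ j
... | yes refl = punchIn i zero , punchInᵢ≢i i zero , punchInᵢ≢i i zero
-- By `3 ≤ n` the number `n ∸ 2` is a successor, so the enumeration has an entry at `zero`.
... | no i≢j   = index (enum-avoid₂ i≢j) zero , sound (enum-avoid₂ i≢j) zero

-- Moves the count from subsets up to `_≐_` to indices up to `_≡_`. Every subset in `P` is some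
-- `S i`, `P-resp` carries its membership over to that `S i`, and injectivity of `S` makes the index
-- unique.
numberOf-family : {X : Set ℓ} {P : Pred (Pred X ℓ) p} (S : I → Pred X ℓ) →
  (∀ {i j} → S i ≐ S j → i ≡ j) →
  (∀ {T U} → T ≐ U → T ∈ P → U ∈ P) →
  (∀ {T} → T ∈ P → ∃[ i ] T ≐ S i) →
  Enumeration (λ i → S i ∈ P) k → NumberOf P Is k
numberOf-family {P = P} S S-injective P-resp P⊆S e = record
  { to        = λ (_ , T∈P) → proj₁ (position T∈P)
  ; from      = λ j → S (index e j) , sound e j
  ; to-cong   = λ {(_ , T∈P)} {(_ , U∈P)} T≐U → position-cong T∈P U∈P T≐U
  ; from-cong = λ { refl → (λ z → z) , (λ z → z) }
  ; inverse   = (λ {j} {(_ , T∈P)} eq → injective e (S-injective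
                    (≐-trans (≐-sym (proj₂ (position T∈P))) eq)))
              , (λ { {_ , T∈P} refl → ≐-sym (proj₂ (position T∈P)) })
  }
  where
  position : ∀ {T} → T ∈ P → ∃[ j ] T ≐ S (index e j)
  position {T} T∈P =
    let (i , T≐Si) = P⊆S T∈P
        (j , eq)   = complete e (P-resp T≐Si T∈P)
    in j , subst (λ i → T ≐ S i) (sym eq) T≐Si

  -- `position` is read off a proof of membership. The sets it selects for `T` and `U` are
  -- nevertheless equal up to `_≐_`, and injectivity of `S` and of the enumeration then forces equal
  -- positions.
  position-cong : ∀ {T U} (T∈P : T ∈ P) (U∈P : U ∈ P) → T ≐ U →
    proj₁ (position T∈P) ≡ proj₁ (position U∈P)
  position-cong T∈P U∈P T≐U = injective e (S-injective
    (≐-trans (≐-sym (proj₂ (position T∈P))) (≐-trans T≐U (proj₂ (position U∈P)))))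

-- Families of blocks obtained by exchanging one point

exchange : {X : Set ℓ} (u v : Fin n → X) → Fin n → Pred X ℓ
exchange u v i = (image u ∖ ｛ u i ｝) ∪ ｛ v i ｝

module Exchange {X : Set ℓ} {u v : Fin n → X} (lab : DisjointLabelling u v) where
  open DisjointLabelling lab

  Through : X → X → Pred (Fin n) ℓ
  Through x y i = x ∈ exchange u v i × y ∈ exchange u v i

  u∈⇒≢ : ∀ {i p} → u p ∈ exchange u v i → i ≢ p
  u∈⇒≢ (inj₁ (_ , up≢ui)) refl = up≢ui refl
  u∈⇒≢ (inj₂ vi≡up)       _    = disjoint ((_ , refl) , (_ , vi≡up))

  ≢⇒u∈ : ∀ {i p} → i ≢ p → u p ∈ exchange u v i
  ≢⇒u∈ i≢p = inj₁ ((_ , refl) , λ eq → i≢p (a-injective eq))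

  v∈⇒≡ : ∀ {i q} → v q ∈ exchange u v i → i ≡ q
  v∈⇒≡ (inj₁ (vq∈u , _)) = contradiction (vq∈u , (_ , refl)) disjoint
  v∈⇒≡ (inj₂ vi≡vq)      = b-injective vi≡vq

  ≡⇒v∈ : ∀ {i q} → i ≡ q → v q ∈ exchange u v i
  ≡⇒v∈ refl = inj₂ refl

  -- A block is determined by the one point of `image v` that it contains.
  exchange-injective : ∀ {i j} → exchange u v i ≐ exchange u v j → i ≡ j
  exchange-injective (Si⊆Sj , _) = sym (v∈⇒≡ (Si⊆Sj (≡⇒v∈ refl)))

  through-uu : ∀ {x y} → x ∈ image u → y ∈ image u → x ≢ y → Enumeration (Through x y) (n ∸ 2)
  through-uu (p , refl) (q , refl) x≢y = enum-resp-≐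
    ( (λ (i≢p , i≢q) → ≢⇒u∈ i≢p , ≢⇒u∈ i≢q)
    , (λ (x∈ , y∈) → u∈⇒≢ x∈ , u∈⇒≢ y∈))
    (enum-avoid₂ (λ p≡q → x≢y (cong u p≡q)))

  through-vv : ∀ {x y} → x ∈ image v → y ∈ image v → x ≢ y → Enumeration (Through x y) 0
  through-vv (p , refl) (q , refl) x≢y =
    enum-empty λ (x∈ , y∈) → x≢y (cong v (trans (sym (v∈⇒≡ x∈)) (v∈⇒≡ y∈)))

  -- Containing `v q` forces the index to be `q`, and this block contains `u p` unless `q ≡ p`.
  through-uv : ∀ {x y} → x ∈ image u → y ∈ image v →
    ∃[ k ] Enumeration (Through x y) k × (k ≡ 0 ⊎ k ≡ 1)
  through-uv (p , refl) (q , refl) with q ≟ p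
  ... | yes refl = 0 , enum-empty (λ (x∈ , y∈) → u∈⇒≢ x∈ (v∈⇒≡ y∈)) , inj₁ refl
  ... | no q≢p   = 1 , enum-resp-≐
    ( (λ { refl → ≢⇒u∈ q≢p , ≡⇒v∈ refl })
    , (λ (_ , y∈) → sym (v∈⇒≡ y∈)))
    (enum-singleton q) , inj₂ refl

  through-vu : ∀ {x y} → x ∈ image v → y ∈ image u →
    ∃[ k ] Enumeration (Through x y) k × (k ≡ 0 ⊎ k ≡ 1)
  through-vu x∈v y∈u =
    let (k , e , k≤1) = through-uv y∈u x∈v in k , enum-resp-≐ (swap , swap) e , k≤1

0or1+0or1 : (k ≡ 0 ⊎ k ≡ 1) → (l ≡ 0 ⊎ l ≡ 1) → k + l ≡ 0 ⊎ k + l ≡ 1 ⊎ k + l ≡ 2 ⊎ k + l ≡ n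
0or1+0or1 (inj₁ refl) (inj₁ refl) = inj₁ refl
0or1+0or1 (inj₁ refl) (inj₂ refl) = inj₂ (inj₁ refl)
0or1+0or1 (inj₂ refl) (inj₁ refl) = inj₂ (inj₁ refl)
0or1+0or1 (inj₂ refl) (inj₂ refl) = inj₂ (inj₂ (inj₁ refl))

-- Combining the two families of the Möbius pair

module MöbiusPair {X : Set ℓ} (3≤n : 3 ≤ n) (φ : Permutation′ n)
    {a b : Fin n → X} (lab : DisjointLabelling a b) where
  open DisjointLabelling lab
  open PointBlockStructure (möbiusPair φ a b)

  aφ : Fin n → X
  aφ i = a (φ ⟨$⟩ʳ i)

  -- Reindexing by a permutation keeps the image, so points of `image a` can also serve as exchanged
  -- points of the second family.
  image-aφ : ∀ {x} → x ∈ image a → x ∈ image aφ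
  image-aφ (p , ap≡x) = φ ⟨$⟩ˡ p , trans (cong a (inverseʳ φ)) ap≡x

  lab′ : DisjointLabelling b aφ
  lab′ = record
    -- The roles are swapped: `b` becomes the first labelling, and the second is `aφ`, a composite
    -- of injections.
    { a-injective = b-injective
    ; b-injective = λ eq → Injection.injective (Inverse⇒Injection φ) (a-injective eq)
    ; disjoint    = λ (x∈b , (i , eq)) → disjoint ((φ ⟨$⟩ʳ i , eq) , x∈b)
    }

  module A = Exchange lab
  module B = Exchange lab′

  -- The two branches unfold to `exchange a b` and `exchange b aφ`, so the results in `A` and `B`
  -- apply to them directly.
  block : Fin n ⊎ Fin n → Pred X ℓ
  block = [ blockA φ a b , blockB φ a b ]

  -- Aᵢ contains only one element of B, whereas Bⱼ contains n - 1 ≥ 2 of them.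
  blockB⊈blockA : ∀ j i → blockB φ a b j ⊈ blockA φ a b i
  blockB⊈blockA j i Bj⊆Ai =
    let (h , h≢i , h≢j) = avoid₂ 3≤n i j
    in h≢i (sym (A.v∈⇒≡ (Bj⊆Ai (B.≢⇒u∈ (λ j≡h → h≢j (sym j≡h))))))

  block-injective : ∀ s t → block s ≐ block t → s ≡ t
  block-injective (inj₁ i) (inj₁ j) eq        = cong inj₁ (A.exchange-injective eq)
  block-injective (inj₁ i) (inj₂ j) (_ , t⊆s) = ⊥-elim (blockB⊈blockA j i t⊆s)
  block-injective (inj₂ i) (inj₁ j) (s⊆t , _) = ⊥-elim (blockB⊈blockA i j s⊆t)
  block-injective (inj₂ i) (inj₂ j) eq        = cong inj₂ (B.exchange-injective eq)

  isBlock : ∀ s → block s ∈ Block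
  isBlock (inj₁ i) = inj₁ (i , (λ z → z) , (λ z → z))
  isBlock (inj₂ i) = inj₂ (i , (λ z → z) , (λ z → z))

  blockThrough-resp-≐ : ∀ {x y S T} → S ≐ T → BlockThrough x y S → BlockThrough x y T
  blockThrough-resp-≐ S≐T@(S⊆T , _) (S∈Block , x∈S , y∈S) =
    Sum.map (λ (i , eq) → i , ≐-trans (≐-sym S≐T) eq)
            (λ (i , eq) → i , ≐-trans (≐-sym S≐T) eq) S∈Block , S⊆T x∈S , S⊆T y∈S

  -- By `block-injective` no block is counted twice, within a family or across the two.
  numberOf-+ : ∀ {x y} → Enumeration (A.Through x y) k → Enumeration (B.Through x y) l →
    NumberOf (BlockThrough x y) Is (k + l)
  numberOf-+ {x = x} {y} eA eB = numberOf-family block (λ {s} {t} → block-injective s t)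
    blockThrough-resp-≐
    (λ { (inj₁ (i , eq) , _) → inj₁ i , eq ; (inj₂ (i , eq) , _) → inj₂ i , eq })
    -- Each `block s` is a block, so only the membership of `x` and `y` remains to be enumerated.
    (enum-resp-≐ ((λ {s} (x∈ , y∈) → isBlock s , x∈ , y∈) , proj₂)
      (enum-⊎ {P = λ s → x ∈ block s × y ∈ block s} eA eB))

proposition1p5 : ∀ {ℓ} {X : Set ℓ} (n : ℕ) → 3 ≤ n → (φ : Permutation′ n)
    (a b : Fin n → X) → DisjointLabelling a b →
    let open PointBlockStructure (möbiusPair φ a b) in
    (x y : X) → x ∈ Point → y ∈ Point → x ≢ y →
    ∃[ k ] (NumberOf (BlockThrough x y) Is k) × (k ≡ 0 ⊎ k ≡ 1 ⊎ k ≡ 2 ⊎ k ≡ n ∸ 2)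
proposition1p5 n 3≤n φ a b lab x y x∈Point y∈Point x≢y = count x∈Point y∈Point
  where
  open PointBlockStructure (möbiusPair φ a b)
  open MöbiusPair 3≤n φ lab

  count : x ∈ Point → y ∈ Point →
    ∃[ k ] (NumberOf (BlockThrough x y) Is k) × (k ≡ 0 ⊎ k ≡ 1 ⊎ k ≡ 2 ⊎ k ≡ n ∸ 2)
  -- When both points lie on the same side, one family contributes `n ∸ 2` blocks and the other
  -- none.
  count (inj₁ x∈a) (inj₁ y∈a) =
    n ∸ 2 + 0
    , numberOf-+ (A.through-uu x∈a y∈a x≢y) (B.through-vv (image-aφ x∈a) (image-aφ y∈a) x≢y)
    , inj₂ (inj₂ (inj₂ (+-identityʳ (n ∸ 2))))
  count (inj₂ x∈b) (inj₂ y∈b) =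
    n ∸ 2
    , numberOf-+ (A.through-vv x∈b y∈b x≢y) (B.through-uu x∈b y∈b x≢y)
    , inj₂ (inj₂ (inj₂ refl))
  -- When the points lie on different sides, each family contributes at most one block, hence at
  -- most two in all.
  count (inj₁ x∈a) (inj₂ y∈b) =
    let (k , eA , k≤1) = A.through-uv x∈a y∈b
        (l , eB , l≤1) = B.through-vu (image-aφ x∈a) y∈b
    in k + l , numberOf-+ eA eB , 0or1+0or1 k≤1 l≤1
  count (inj₂ x∈b) (inj₁ y∈a) =
    let (k , eA , k≤1) = A.through-vu x∈b y∈a
        (l , eB , l≤1) = B.through-uv x∈b (image-aφ y∈a)
    in k + l , numberOf-+ eA eB , 0or1+0or1 k≤1 l≤1
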